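{- For each even integer $h\geq 2$, there is a poset of height $h$ with dimension at least $2^{h/2}$ whose cover graph excludes $K_5$ as a minor.
   Context: All posets are finite. The height of a poset is the maximum size of a chain in it. The dimension of a poset $P$ is the least integer $d$ such that $P$ is the intersection of $d$ linear orders. A cover relation of $P$ is a relation $a\leq b$ in $P$ with $a\neq b$ such that there is no element $c$ distinct from $a,b$ with $a\leq c\leq b$ in $P$. The cover graph of $P$ is the undirected graph whose vertices are the elements of $P$ and in which two elements are adjacent if they are in a cover relation in $P$. -}

module Defs where

open import Level using (0ℓ)
open import Data.Fin.Base using (Fin)
open import Data.Nat.Base as ℕ using (ℕ)
open import Data.Product.Base using (Σ; ∃; ∃₂; _×_; _,_)
open import Data.Sum.Base using (_⊎_; inj₁; inj₂; swap)
open import Function.Base using (_∘_)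
open import Function.Bundles using (_↔_; _↣_; _⇔_; module Injection)
open import Relation.Binary.Construct.Closure.ReflexiveTransitive using (Star)
open import Relation.Binary.Core using (Rel)
open import Relation.Binary.Definitions using (Symmetric)
open import Relation.Binary.PropositionalEquality using (_≡_; _≢_; refl; sym)
open import Relation.Binary.Structures using (IsDecPartialOrder; IsTotalOrder)
open import Relation.Nullary.Negation using (¬_)
open import Relation.Unary using (Pred; Decidable; Satisfiable; _∈_; _⊥_)

record FinPoset : Set₁ where
  infix 4 _≤_
  field
    Carrier           : Set
    _≤_               : Rel Carrier 0ℓ
    isDecPartialOrder : IsDecPartialOrder _≡_ _≤_
    size              : ℕ
    enumeration       : Carrier ↔ Fin size

record Graph : Set₁ where
  field
    Vertex   : Set
    Adj      : Rel Vertex 0ℓ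
    adj-sym  : Symmetric Adj
    loopless : ∀ {x} → ¬ Adj x x

module _ (P : FinPoset) where
  open FinPoset P

  -- A chain of size k is a k-element set of pairwise comparable elements,
  -- given here by an injective listing in an arbitrary order.
  HasChain : ℕ → Set
  HasChain k = Σ (Fin k ↣ Carrier) λ f → let open Injection f in
    ∀ i j → to i ≤ to j ⊎ to j ≤ to i

  HasHeight : ℕ → Set
  HasHeight h = HasChain h × (∀ k → HasChain k → k ℕ.≤ h)

  -- The linear orders need not be distinct.
  IsIntersectionOfLinearOrders : ℕ → Set₁
  IsIntersectionOfLinearOrders d = Σ (Fin d → Rel Carrier 0ℓ) λ L →
    (∀ i → IsTotalOrder _≡_ (L i)) ×
    (∀ x y → x ≤ y ⇔ (∀ i → L i x y))

  HasDimension : ℕ → Set₁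
  HasDimension d = IsIntersectionOfLinearOrders d ×
    (∀ e → IsIntersectionOfLinearOrders e → d ℕ.≤ e)

  Cover : Rel Carrier 0ℓ
  Cover a b = a ≤ b × a ≢ b ×
    ¬ (∃ λ c → c ≢ a × c ≢ b × a ≤ c × c ≤ b)

  coverGraph : Graph
  coverGraph = record
    { Vertex   = Carrier
    ; Adj      = λ a b → Cover a b ⊎ Cover b a
    ; adj-sym  = swap
    ; loopless = λ { (inj₁ (_ , a≢a , _)) → a≢a refl
                   ; (inj₂ (_ , a≢a , _)) → a≢a refl }
    }

K : ℕ → Graph
K n = record
  { Vertex   = Fin n
  ; Adj      = _≢_
  ; adj-sym  = λ x≢y → x≢y ∘ sym
  ; loopless = λ x≢x → x≢x refl
  }

module _ (G : Graph) where
  open Graph G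

  InducesConnected : Pred Vertex 0ℓ → Set
  InducesConnected U = ∀ {x y} → x ∈ U → y ∈ U →
    Star (λ u v → u ∈ U × v ∈ U × Adj u v) x y

infix 4 _IsMinorOf_

-- H is a minor of G when G contains a model of H: disjoint connected branch
-- sets, one per vertex of H, such that contracting them yields a graph
-- containing H.  Vertex sets are taken to be decidable, as subsets of a
-- finite set classically are.
record _IsMinorOf_ (H G : Graph) : Set₁ where
  private
    module H = Graph H
    module G = Graph G
  field
    branch    : H.Vertex → Pred G.Vertex 0ℓ
    branch?   : ∀ v → Decidable (branch v)
    nonempty  : ∀ v → Satisfiable (branch v)
    connected : ∀ v → InducesConnected G (branch v)
    disjoint  : ∀ {u v} → u ≢ v → branch u ⊥ branch v
    joined    : ∀ {u v} → H.Adj u v →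
                ∃₂ λ x y → x ∈ branch u × y ∈ branch v × G.Adj x y

{-# OPTIONS --safe #-}

-- Let h = 2m.  For every nonempty binary word w of length at most m take two
-- elements a_w and b_w; the a's form a binary forest growing downwards, the b's
-- one growing upwards, and a_u ≤ b_v when neither word extends the other.  The
-- words of length m index a standard example, so the dimension is at least 2^m.
--
-- The cover graph arises by 2-sums of copies of K₃,₃: each node w contributes
-- {a_w, b_w, a_0w, b_0w, a_1w, b_1w}, glued to its neighbours along pairs
-- {a_u, b_u}.  Given a model of K₅, go up the tree as long as some branch set
-- lies strictly above the current node.  Where this stops, every branch set
-- meets the six vertices of the node.  At least four meet them in just one
-- vertex, so two of these have vertices in the same colour class of K₃,₃, and
-- then the two branch sets cannot be joined by an edge.
module Submission where

open import Data.Bool.Base as Bool using (Bool; true; false; not; f≤t; b≤b)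
import Data.Bool.Properties as Bool
open import Data.Empty using (⊥; ⊥-elim)
open import Data.Fin.Base using (Fin; toℕ; fromℕ<; combine)
open import Data.Fin.Patterns
import Data.Fin.Properties as Fin
open import Data.Integer.Base as ℤ using (ℤ; +_; -[1+_]; -≤-; -≤+; +≤+)
import Data.Integer.Properties as ℤ
open import Data.Irrelevant using ([_])
open import Data.List.Base using (List; []; _∷_; length; replicate)
open import Data.List.Properties using (length-replicate; ≡-dec)
open import Data.Maybe.Base using (Maybe; just; nothing)
import Data.Maybe.Properties as Maybe
open import Data.Nat
  using (ℕ; suc; _≤_; _<_; _+_; _*_; _^_; _/_; z≤n; s≤s; s≤s⁻¹; z<s; _≤′_; ≤′-reflexive; ≤′-step)
open import Data.Nat.Binary.Base as ℕᵇ using (ℕᵇ; 2[1+_]; 1+[2_])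
import Data.Nat.Binary.Properties as ℕᵇ
open import Data.Nat.DivMod using (m*n/n≡m)
open import Data.Nat.Divisibility using (_∣_; divides)
import Data.Nat.Properties as ℕ
open import Data.Product using (Σ; Σ-syntax; ∃; ∃-syntax; _×_; _,_; proj₁; proj₂)
open import Data.Product.Function.NonDependent.Propositional using (_×-↔_)
import Data.Product.Properties as Product
open import Data.Product.Relation.Binary.Lex.NonStrict using (×-Lex; ×-isTotalOrder)
open import Data.Refinement using (Refinement-syntax; value; _,_)
open import Data.Sum using (_⊎_; inj₁; inj₂; [_,_]′)
open import Data.Sum.Function.Propositional using (_⊎-↔_)
open import Data.Unit.Base using (⊤; tt)
open import Data.Vec.Base as Vec using (Vec; []; _∷_; toList)
open import Data.Vec.Properties
  using (length-toList; toList∘fromList;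
         cast-is-id)
  renaming (toList-injective to toList-injective-cast)
open import Function.Base using (_∘_; _on_)
open import Function.Bundles
  using (_↔_; Inverse; mk↔ₛ′; mk⇔; mk↣; module Injection; module Equivalence)
open import Function.Construct.Composition using (_↔-∘_)
open import Function.Construct.Identity using (↔-id)
open import Function.Construct.Symmetry using (↔-sym)
open import Function.Definitions using (Injective)
open import Function.Properties.Inverse using (↔⇒↣)
open import Level using (0ℓ)
open import Relation.Binary.Construct.Closure.ReflexiveTransitive using (Star; ε; _◅_)
open import Relation.Binary.Core using (Rel)
open import Relation.Binary.Definitions using (Decidable; Reflexive; Transitive; Antisymmetric)
open import Relation.Binary.PropositionalEquality
  using (_≡_; _≢_; refl; sym; trans; cong; cong₂; subst; ≢-sym; isEquivalence)
open import Relation.Binary.Structures using (IsPartialOrder; IsDecPartialOrder; IsTotalOrder)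
open import Relation.Nullary using (¬_; Dec; yes; no; contradiction)
open import Relation.Nullary.Decidable
  using (map′; recompute; dec-true; dec-false; _×-dec_; ¬?; does; decidable-stable)
import Relation.Unary as U
open import Defs

-- Transported orders and finite search.

on-isPartialOrder : ∀ {A B : Set} {_≈_ _∼_ : Rel B 0ℓ} (f : A → B) →
                    (∀ {x y} → f x ≈ f y → x ≡ y) →
                    IsPartialOrder _≈_ _∼_ → IsPartialOrder _≡_ (_∼_ on f)
on-isPartialOrder f inj po = record
  { isPreorder = record
    { isEquivalence = isEquivalence
    ; reflexive     = λ { refl → P.refl }
    ; trans         = P.trans
    }
  ; antisym    = λ p q → inj (P.antisym p q)
  }
  where module P = IsPartialOrder po

dec-∃ : ∀ {A : Set} {n} → A ↔ Fin n → {P : A → Set} → U.Decidable P → Dec (∃ P)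
dec-∃ A↔Fin {P} P? = map′
  (λ (i , p) → from i , p)
  (λ (x , p) → to x , subst P (sym (strictlyInverseʳ x)) p)
  (Fin.any? (P? ∘ from))
  where open Inverse A↔Fin

Bool×↔Fin : ∀ {A : Set} {n} → A ↔ Fin n → (Bool × A) ↔ Fin (2 * n)
Bool×↔Fin A↔Fin = ↔-sym Fin.*↔× ↔-∘ (↔-sym Fin.2↔Bool ×-↔ A↔Fin)

-- Standard examples and dimension.

module _ (P : FinPoset) where
  open FinPoset P using (Carrier; isDecPartialOrder) renaming (_≤_ to _⊑_)
  open IsDecPartialOrder isDecPartialOrder using () renaming (_≟_ to _≟ᶜ_; reflexive to ⊑-reflexive)

  -- Some order must reverse the pair `u i`, `v i`. An order reversing the pairs of both i and j
  -- would close the cycle u i ≤ v j ≤ u j ≤ v i ≤ u i and identify `u i` with `v i`, so distinct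
  -- pairs need distinct orders.
  standardExample⇒≤ : ∀ {k e} (u v : Fin k → Carrier) →
                      (∀ i → ¬ (u i ⊑ v i)) → (∀ i j → i ≢ j → u i ⊑ v j) →
                      IsIntersectionOfLinearOrders P e → k ≤ e
  standardExample⇒≤ {k} {e} u v u⋢v u⊑v (L , total-order , ⊑⇔L) =
    Fin.injective⇒≤ {f = proj₁ ∘ reversing} reversing-injective
    where
    module L i = IsTotalOrder (total-order i)

    -- Totality and decidable equality make each order decidable, so that a reversing order can be
    -- found by finite search.
    L? : ∀ i → Decidable (L i)
    L? i x y with x ≟ᶜ y | L.total i x y
    ... | yes x≡y | _        = yes (L.reflexive i x≡y)
    ... | no  _   | inj₁ x≤y = yes x≤y
    ... | no  x≢y | inj₂ y≤x = no λ x≤y → x≢y (L.antisym i x≤y y≤x)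

    reversing : ∀ i → ∃[ l ] L l (v i) (u i)
    reversing i with Fin.¬∀⟶∃¬ e (λ l → L l (u i) (v i)) (λ l → L? l _ _)
                       (u⋢v i ∘ Equivalence.from (⊑⇔L _ _))
    ... | l , ¬uLv with L.total l (u i) (v i)
    ...   | inj₁ uLv = contradiction uLv ¬uLv
    ...   | inj₂ vLu = l , vLu

    reversing-injective : Injective _≡_ _≡_ (proj₁ ∘ reversing)
    reversing-injective {i} {j} eq with i Fin.≟ j
    ... | yes i≡j = i≡j
    ... | no  i≢j = contradiction (⊑-reflexive u≡v) (u⋢v i)
      where
      l = proj₁ (reversing i)
      u≤v : ∀ {i j} → i ≢ j → L l (u i) (v j)
      u≤v i≢j = Equivalence.to (⊑⇔L _ _) (u⊑v _ _ i≢j) l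
      vⱼ≤uⱼ : L l (v j) (u j)
      vⱼ≤uⱼ = subst (λ l → L l (v j) (u j)) (sym eq) (proj₂ (reversing j))
      u≡v : u i ≡ v i
      u≡v = L.antisym l
        (L.trans l (u≤v i≢j) (L.trans l vⱼ≤uⱼ (u≤v (≢-sym i≢j))))
        (proj₂ (reversing i))

-- The binary tree of words.

-- Words are read from the right, so that u ⊒ v says that u is a descendant of
-- v in the binary tree and the head of a word is the last letter read.
infix 4 _⊒_ _⊐_ _∥_ _⊒?_ _∥?_ _≼_ _≼?_ _⊑_ _≟ᴸ_ _≟ˡᵒᶜ_ _≟ʰ_

data _⊒_ : Rel (List Bool) 0ℓ where
  ⊒-refl : ∀ {u} → u ⊒ u
  ⊒-step : ∀ {c u v} → u ⊒ v → c ∷ u ⊒ v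

_⊐_ : Rel (List Bool) 0ℓ
u ⊐ v = ∃[ c ] u ⊒ c ∷ v

-- Incomparability in positive form: the words fork at a common parent and are then extended
-- independently.
data _∥_ : Rel (List Bool) 0ℓ where
  fork  : ∀ {c d u} → c ≢ d → c ∷ u ∥ d ∷ u
  stepˡ : ∀ {c u v} → u ∥ v → c ∷ u ∥ v
  stepʳ : ∀ {c u v} → u ∥ v → u ∥ c ∷ v

⊒-trans : Transitive _⊒_
⊒-trans ⊒-refl     v⊒w = v⊒w
⊒-trans (⊒-step p) v⊒w = ⊒-step (⊒-trans p v⊒w)

⊒-pop : ∀ {c u v} → u ⊒ c ∷ v → u ⊒ v
⊒-pop p = ⊒-trans p (⊒-step ⊒-refl)

⊒-[] : ∀ {u} → u ⊒ []
⊒-[] {[]}    = ⊒-refl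
⊒-[] {_ ∷ _} = ⊒-step ⊒-[]

⊒-split : ∀ {u v} → u ⊒ v → u ≡ v ⊎ u ⊐ v
⊒-split ⊒-refl = inj₁ refl
⊒-split (⊒-step p) with ⊒-split p
... | inj₁ refl    = inj₂ (_ , ⊒-refl)
... | inj₂ (c , q) = inj₂ (c , ⊒-step q)

⊒-length : ∀ {u v} → u ⊒ v → length v ≤ length u
⊒-length ⊒-refl     = ℕ.≤-refl
⊒-length (⊒-step p) = ℕ.m≤n⇒m≤1+n (⊒-length p)

⊒⇒⊅ : ∀ {u v} → u ⊒ v → ¬ (v ⊐ u)
⊒⇒⊅ u⊒v (c , v⊒cu) = ℕ.n≮n _ (⊒-length (⊒-trans u⊒v v⊒cu))

⊒-antisym : Antisymmetric _≡_ _⊒_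
⊒-antisym u⊒v v⊒u with ⊒-split v⊒u
... | inj₁ v≡u = sym v≡u
... | inj₂ v⊐u = contradiction v⊐u (⊒⇒⊅ u⊒v)

⊒∧length≡⇒≡ : ∀ {u v} → u ⊒ v → length u ≡ length v → u ≡ v
⊒∧length≡⇒≡ u⊒v eq with ⊒-split u⊒v
... | inj₁ u≡v      = u≡v
... | inj₂ (_ , u⊒) = contradiction (sym eq) (ℕ.<⇒≢ (⊒-length u⊒))

_≟ᴸ_ : Decidable {A = List Bool} _≡_
_≟ᴸ_ = ≡-dec Bool._≟_

_⊒?_ : Decidable _⊒_
[]    ⊒? []      = yes ⊒-refl
[]    ⊒? (_ ∷ _) = no λ ()
c ∷ u ⊒? v with c ∷ u ≟ᴸ v | u ⊒? v
... | yes refl | _       = yes ⊒-refl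
... | no  _    | yes u⊒v = yes (⊒-step u⊒v)
... | no  cu≢v | no  u⋣v = no λ { ⊒-refl → cu≢v refl ; (⊒-step p) → u⋣v p }

⊒-letter-unique : ∀ {u v c d} → u ⊒ c ∷ v → u ⊒ d ∷ v → c ≡ d
⊒-letter-unique ⊒-refl     ⊒-refl     = refl
⊒-letter-unique ⊒-refl     (⊒-step q) = contradiction (_ , q) (⊒⇒⊅ ⊒-refl)
⊒-letter-unique (⊒-step p) ⊒-refl     = contradiction (_ , p) (⊒⇒⊅ ⊒-refl)
⊒-letter-unique (⊒-step p) (⊒-step q) = ⊒-letter-unique p q

∥-sym : ∀ {u v} → u ∥ v → v ∥ u
∥-sym (fork c≢d) = fork (≢-sym c≢d)
∥-sym (stepˡ p)  = stepʳ (∥-sym p)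
∥-sym (stepʳ p)  = stepˡ (∥-sym p)

∥-⊒ʳ : ∀ {u v v′} → u ∥ v → v′ ⊒ v → u ∥ v′
∥-⊒ʳ p ⊒-refl     = p
∥-⊒ʳ p (⊒-step q) = stepʳ (∥-⊒ʳ p q)

∥-⊒ˡ : ∀ {u u′ v} → u′ ⊒ u → u ∥ v → u′ ∥ v
∥-⊒ˡ ⊒-refl     p = p
∥-⊒ˡ (⊒-step q) p = stepˡ (∥-⊒ˡ q p)

-- A common descendant would descend from both children at the fork, yet it continues their parent
-- by only one letter.
∥⇒no-upper-bound : ∀ {u v w} → u ∥ v → w ⊒ u → ¬ (w ⊒ v)
∥⇒no-upper-bound (fork c≢d) p q = c≢d (⊒-letter-unique p q)
∥⇒no-upper-bound (stepˡ r)  p q = ∥⇒no-upper-bound r (⊒-pop p) q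
∥⇒no-upper-bound (stepʳ r)  p q = ∥⇒no-upper-bound r p (⊒-pop q)

∥-irrefl : ∀ {u} → ¬ (u ∥ u)
∥-irrefl p = ∥⇒no-upper-bound p ⊒-refl ⊒-refl

compare : ∀ u v → u ⊒ v ⊎ v ⊒ u ⊎ u ∥ v
compare []      v = inj₂ (inj₁ ⊒-[])
compare (c ∷ u) v with compare u v
... | inj₁ u⊒v        = inj₁ (⊒-step u⊒v)
... | inj₂ (inj₂ u∥v) = inj₂ (inj₂ (stepˡ u∥v))
... | inj₂ (inj₁ v⊒u) with ⊒-split v⊒u
...   | inj₁ refl = inj₁ (⊒-step ⊒-refl)
...   | inj₂ (d , v⊒du) with c Bool.≟ d
...     | yes refl = inj₂ (inj₁ v⊒du)
...     | no  c≢d  = inj₂ (inj₂ (∥-⊒ʳ (fork c≢d) v⊒du))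

_∥?_ : Decidable _∥_
u ∥? v with compare u v
... | inj₁ u⊒v        = no λ u∥v → ∥⇒no-upper-bound u∥v ⊒-refl u⊒v
... | inj₂ (inj₁ v⊒u) = no λ u∥v → ∥⇒no-upper-bound u∥v v⊒u ⊒-refl
... | inj₂ (inj₂ u∥v) = yes u∥v

-- The order on the two copies of the tree.

Location : Set
Location = Bool × List Bool

pattern a u = false , u
pattern b u = true , u

data _≼_ : Rel Location 0ℓ where
  a≼a : ∀ {u v} → u ⊒ v → a u ≼ a v
  b≼b : ∀ {u v} → v ⊒ u → b u ≼ b v
  a≼b : ∀ {u v} → u ∥ v → a u ≼ b v

≼-refl : Reflexive _≼_
≼-refl {a _} = a≼a ⊒-refl
≼-refl {b _} = b≼b ⊒-refl

≼-trans : Transitive _≼_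
≼-trans (a≼a p) (a≼a q) = a≼a (⊒-trans p q)
≼-trans (a≼a p) (a≼b q) = a≼b (∥-⊒ˡ p q)
≼-trans (b≼b p) (b≼b q) = b≼b (⊒-trans q p)
≼-trans (a≼b p) (b≼b q) = a≼b (∥-⊒ʳ p q)

≼-antisym : Antisymmetric _≡_ _≼_
≼-antisym (a≼a p) (a≼a q) = cong (false ,_) (⊒-antisym p q)
≼-antisym (b≼b p) (b≼b q) = cong (true ,_) (⊒-antisym q p)

_≼?_ : Decidable _≼_
a u ≼? a v = map′ a≼a (λ { (a≼a p) → p }) (u ⊒? v)
a u ≼? b v = map′ a≼b (λ { (a≼b p) → p }) (u ∥? v)
b u ≼? a v = no λ ()
b u ≼? b v = map′ b≼b (λ { (b≼b p) → p }) (v ⊒? u)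

≼-isPartialOrder : IsPartialOrder _≡_ _≼_
≼-isPartialOrder = record
  { isPreorder = record
    { isEquivalence = isEquivalence
    ; reflexive     = λ { refl → ≼-refl }
    ; trans         = ≼-trans
    }
  ; antisym    = ≼-antisym
  }

_≟ˡᵒᶜ_ : Decidable {A = Location} _≡_
_≟ˡᵒᶜ_ = Product.≡-dec Bool._≟_ _≟ᴸ_

-- The finite posets, on nonempty words of length at most `suc n`.

Word : ℕ → Set
Word n = [ w ∈ List Bool ∣ length w ≤ n ]

wordCount : ℕ → ℕ
wordCount 0       = 1
wordCount (suc n) = 1 + 2 * wordCount n

Word↔Fin : ∀ n → Word n ↔ Fin (wordCount n)
Word↔Fin 0 = ↔-sym Fin.1↔⊤ ↔-∘ contract
  where
  contract : Word 0 ↔ ⊤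
  contract = mk↔ₛ′ (λ _ → tt) (λ _ → [] , [ z≤n ]) (λ _ → refl) (λ { ([] , _) → refl })
Word↔Fin (suc n) =
  ↔-sym (Fin.+↔⊎ {1}) ↔-∘ ((↔-sym Fin.1↔⊤ ⊎-↔ Bool×↔Fin (Word↔Fin n)) ↔-∘ uncons)
  where
  uncons : Word (suc n) ↔ (⊤ ⊎ (Bool × Word n))
  uncons = mk↔ₛ′
    (λ { ([] , _) → inj₁ tt ; (c ∷ w , [ ℓ ]) → inj₂ (c , w , [ s≤s⁻¹ ℓ ]) })
    (λ { (inj₁ tt) → [] , [ z≤n ] ; (inj₂ (c , w , [ ℓ ])) → c ∷ w , [ s≤s ℓ ] })
    (λ { (inj₁ tt) → refl ; (inj₂ _) → refl })
    (λ { ([] , _) → refl ; (_ ∷ _ , _) → refl })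

-- The factors are the side, the last letter, and the remaining letters.
Element : ℕ → Set
Element n = Bool × Bool × Word n

loc : ∀ {n} → Element n → Location
loc (s , c , w) = s , c ∷ value w

-- The length bound in `Word` is irrelevant, so side and list alone determine an element.
loc-injective : ∀ {n} {x y : Element n} → loc x ≡ loc y → x ≡ y
loc-injective refl = refl

side : ∀ {n} → Element n → Bool
side = proj₁ ∘ loc

word : ∀ {n} → Element n → List Bool
word = proj₂ ∘ loc

element : ∀ {n} s u → 0 < length u → length u ≤ suc n → Σ[ x ∈ Element n ] loc x ≡ (s , u)
element s (c ∷ u) _ ℓ = (s , c , u , [ s≤s⁻¹ ℓ ]) , refl

word-length : ∀ {n} (x : Element n) → length (word x) ≤ suc n
word-length (_ , _ , w , [ ℓ ]) = s≤s (recompute (length w ℕ.≤? _) ℓ)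

_⊑_ : ∀ {n} → Rel (Element n) 0ℓ
_⊑_ = _≼_ on loc

poset : ℕ → FinPoset
poset n = record
  { Carrier           = Element n
  ; _≤_               = _⊑_
  ; isDecPartialOrder = record
    { isPartialOrder = on-isPartialOrder loc loc-injective ≼-isPartialOrder
    ; _≟_            = λ x y → map′ loc-injective (cong loc) (loc x ≟ˡᵒᶜ loc y)
    ; _≤?_           = λ x y → loc x ≼? loc y
    }
  ; size              = 2 * (2 * wordCount n)
  ; enumeration       = Bool×↔Fin (Bool×↔Fin (Word↔Fin n))
  }

-- Height.

module _ (n : ℕ) where
  private
    P = poset n

  rank : Element n → Fin (suc n * 2)
  rank (s , _ , w , [ ℓ ]) = combine (fromℕ< (s≤s ℓ)) (Inverse.from Fin.2↔Bool s)

  rank-determines : ∀ x y → rank x ≡ rank y → side x ≡ side y × length (word x) ≡ length (word y)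
  rank-determines (s , _ , _ , [ ℓ ]) (t , _ , _ , [ ℓ′ ]) eq with Fin.combine-injective _ _ _ _ eq
  ... | i≡j , s≡t = Injection.injective (↔⇒↣ (↔-sym Fin.2↔Bool)) s≡t
                  , cong suc (Fin.fromℕ<-injective _ _ (s≤s ℓ) (s≤s ℓ′) i≡j)

  comparable∧side≡∧length≡⇒≡ : ∀ {p q : Location} → p ≼ q → proj₁ p ≡ proj₁ q →
                       length (proj₂ p) ≡ length (proj₂ q) → p ≡ q
  comparable∧side≡∧length≡⇒≡ (a≼a u⊒v) _ eq = cong (false ,_) (⊒∧length≡⇒≡ u⊒v eq)
  comparable∧side≡∧length≡⇒≡ (b≼b v⊒u) _ eq = cong (true ,_) (sym (⊒∧length≡⇒≡ v⊒u (sym eq)))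

  -- Comparable elements that agree in side and word length coincide, so a chain injects into the
  -- pairs of a length and a side.
  chain-length≤ : ∀ k → HasChain P k → k ≤ suc n * 2
  chain-length≤ k (f , comparable) = Fin.injective⇒≤ {f = rank ∘ to} λ {i} {j} eq →
    let s≡t , ℓ≡ℓ′ = rank-determines (to i) (to j) eq in
    injective (loc-injective ([ (λ p → comparable∧side≡∧length≡⇒≡ p s≡t ℓ≡ℓ′)
                             , (λ p → sym (comparable∧side≡∧length≡⇒≡ p (sym s≡t) (sym ℓ≡ℓ′)))
                             ]′ (comparable i j)))
    where open Injection f

  replicate-⊒ : ∀ {c j k} → j ≤′ k → replicate k c ⊒ replicate j c
  replicate-⊒ (≤′-reflexive refl) = ⊒-refl
  replicate-⊒ (≤′-step p)         = ⊒-step (replicate-⊒ p)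

  replicate-∥ : ∀ {c d} → c ≢ d → ∀ j k → replicate (suc j) c ∥ replicate (suc k) d
  replicate-∥ c≢d j k = ∥-⊒ˡ (above-one j) (∥-⊒ʳ (fork c≢d) (above-one k))
    where
    above-one : ∀ {c} k → replicate (suc k) c ⊒ c ∷ []
    above-one k = replicate-⊒ (ℕ.≤⇒≤′ (s≤s (z≤n {k})))

  -- The chain is ... < a_00 < a_0 < b_1 < b_11 < ...: the side doubles as the repeated letter, so
  -- words from opposite sides fork at the root.
  longChain : HasChain P (suc n * 2)
  longChain = mk↣ (Injection.injective (↔⇒↣ code) ∘ zigzag-injective) , λ i j → comparable (to i) (to j)
    where
    code : Fin (suc n * 2) ↔ (Fin (suc n) × Bool)
    code = (↔-id _ ×-↔ Fin.2↔Bool) ↔-∘ Fin.*↔×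
    open Inverse code using (to)

    zigzag : Fin (suc n) × Bool → Element n
    zigzag (i , s) = s , s , replicate (toℕ i) s , 
      [ ℕ.≤-trans (ℕ.≤-reflexive (length-replicate _)) (s≤s⁻¹ (Fin.toℕ<n i)) ]

    zigzag-injective : ∀ {i j} → zigzag i ≡ zigzag j → i ≡ j
    zigzag-injective {i , s} {j , t} eq = cong₂ _,_
      (Fin.toℕ-injective (trans (sym (length-replicate _))
        (trans (cong (λ x → length (value (proj₂ (proj₂ x)))) eq) (length-replicate _))))
      (cong side eq)

    comparable : ∀ i j → zigzag i ⊑ zigzag j ⊎ zigzag j ⊑ zigzag i
    comparable (i , false) (j , true)  = inj₁ (a≼b (replicate-∥ (λ ()) (toℕ i) (toℕ j)))
    comparable (i , true)  (j , false) = inj₂ (a≼b (replicate-∥ (λ ()) (toℕ j) (toℕ i)))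
    comparable (i , false) (j , false) with ℕ.≤-total (toℕ i) (toℕ j)
    ... | inj₁ i≤j = inj₂ (a≼a (replicate-⊒ (ℕ.≤⇒≤′ (s≤s i≤j))))
    ... | inj₂ j≤i = inj₁ (a≼a (replicate-⊒ (ℕ.≤⇒≤′ (s≤s j≤i))))
    comparable (i , true)  (j , true)  with ℕ.≤-total (toℕ i) (toℕ j)
    ... | inj₁ i≤j = inj₁ (b≼b (replicate-⊒ (ℕ.≤⇒≤′ (s≤s i≤j))))
    ... | inj₂ j≤i = inj₂ (b≼b (replicate-⊒ (ℕ.≤⇒≤′ (s≤s j≤i))))

  height : HasHeight P (suc n * 2)
  height = longChain , chain-length≤

-- Linear extensions.

code : List Bool → ℕᵇ
code []          = ℕᵇ.zero
code (false ∷ u) = 1+[2 code u ]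
code (true ∷ u)  = 2[1+ code u ]

code-injective : ∀ {u v} → code u ≡ code v → u ≡ v
code-injective {[]}        {[]}        _  = refl
code-injective {false ∷ u} {false ∷ v} eq = cong (false ∷_) (code-injective (1+[2-injective eq))
  where
  1+[2-injective : ∀ {x y} → 1+[2 x ] ≡ 1+[2 y ] → x ≡ y
  1+[2-injective refl = refl
code-injective {true ∷ u}  {true ∷ v}  eq = cong (true ∷_) (code-injective (2[1+-injective eq))
  where
  2[1+-injective : ∀ {x y} → 2[1+ x ] ≡ 2[1+ y ] → x ≡ y
  2[1+-injective refl = refl
code-injective {[]}        {false ∷ _} ()
code-injective {[]}        {true ∷ _}  ()
code-injective {false ∷ _} {[]}        ()
code-injective {false ∷ _} {true ∷ _}  ()
code-injective {true ∷ _}  {[]}        ()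
code-injective {true ∷ _}  {false ∷ _} ()

-- Bijective base 2 with the head as lowest digit: injective, and monotone under extension of words.
number : List Bool → ℕ
number = ℕᵇ.toℕ ∘ code

number-mono : ∀ {u v} → u ⊒ v → number v ≤ number u
number-mono ⊒-refl                     = ℕ.≤-refl
number-mono (⊒-step {c = false} {u} p) = ℕ.m≤n⇒m≤1+n (ℕ.≤-trans (number-mono p) (ℕ.m≤n*m (number u) 2))
number-mono (⊒-step {c = true}  {u} p) = ℕ.≤-trans (ℕ.m≤n⇒m≤1+n (number-mono p)) (ℕ.m≤n*m (suc (number u)) 2)

-- A linear extension with all `a` locations before all `b` locations; it breaks ties within the
-- early and within the late part.
position : Location → ℤ
position (a u) = -[1+ number u ]
position (b v) = + number v

position-injective : ∀ {p q} → position p ≡ position q → p ≡ q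
position-injective {a u} {a v} eq = cong (false ,_) (code-injective (ℕᵇ.toℕ-injective (ℤ.-[1+-injective eq)))
position-injective {b u} {b v} eq = cong (true ,_) (code-injective (ℕᵇ.toℕ-injective (ℤ.+-injective eq)))
position-injective {a _} {b _} ()
position-injective {b _} {a _} ()

position-mono : ∀ {p q} → p ≼ q → position p ℤ.≤ position q
position-mono (a≼a u⊒v) = -≤- (number-mono u⊒v)
position-mono (b≼b v⊒u) = +≤+ (number-mono v⊒u)
position-mono (a≼b _)   = -≤+

-- The linear extension for w starts with the down-set of b_w: this puts b_v
-- below a_u whenever w descends from both u and v.
module _ (w : List Bool) where

  late : Location → Bool
  late (a u) = does (w ⊒? u)
  late (b v) = not (does (w ⊒? v))

  -- Within a side this is transitivity of `⊒`. Across sides, `a u` late and `b v` early would make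
  -- w a descendant of two incomparable words.
  late-mono : ∀ {p q} → p ≼ q → late p Bool.≤ late q
  late-mono (a≼a {u} {v} u⊒v) with w ⊒? u | w ⊒? v
  ... | yes _   | yes _  = b≤b
  ... | yes w⊒u | no w⋣v = contradiction (⊒-trans w⊒u u⊒v) w⋣v
  ... | no  _   | _      = Bool.≤-minimum _
  late-mono (b≼b {u} {v} v⊒u) with w ⊒? u | w ⊒? v
  ... | yes _   | _       = Bool.≤-minimum _
  ... | no  _   | no _    = b≤b
  ... | no  w⋣u | yes w⊒v = contradiction (⊒-trans w⊒v v⊒u) w⋣u
  late-mono (a≼b {u} {v} u∥v) with w ⊒? u | w ⊒? v
  ... | yes w⊒u | yes w⊒v = contradiction w⊒v (∥⇒no-upper-bound u∥v w⊒u)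
  ... | yes _   | no _    = b≤b
  ... | no  _   | _       = Bool.≤-minimum _

  key : Location → Bool × ℤ
  key p = late p , position p

  Before : Rel Location 0ℓ
  Before = ×-Lex _≡_ Bool._≤_ ℤ._≤_ on key

  before-isTotalOrder : IsTotalOrder _≡_ Before
  before-isTotalOrder = record
    { isPartialOrder = on-isPartialOrder key (position-injective ∘ proj₂) T.isPartialOrder
    ; total          = λ p q → T.total (key p) (key q)
    }
    where module T = IsTotalOrder (×-isTotalOrder Bool._≟_ Bool.≤-isTotalOrder ℤ.≤-isTotalOrder)

  before-mono : ∀ p q → late p Bool.≤ late q → position p ℤ.≤ position q → Before p q
  before-mono p q l z with late p Bool.≟ late q
  ... | yes l≡ = inj₂ (l≡ , z)
  ... | no  l≢ = inj₁ (l , l≢)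

  ≼⇒before : ∀ p q → p ≼ q → Before p q
  ≼⇒before p q p≼q = before-mono p q (late-mono p≼q) (position-mono p≼q)

  early-before-late : ∀ p q → late p ≡ false → late q ≡ true → Before p q
  early-before-late p q p-early q-late with late p | late q | p-early | q-late
  ... | _ | _ | refl | refl = inj₁ (f≤t , λ ())

  a-late : ∀ {u} → w ⊒ u → late (a u) ≡ true
  a-late = dec-true (w ⊒? _)

  a-early : ∀ {u} → ¬ (w ⊒ u) → late (a u) ≡ false
  a-early = dec-false (w ⊒? _)

  b-early : ∀ {v} → w ⊒ v → late (b v) ≡ false
  b-early = cong not ∘ dec-true (w ⊒? _)

  b-late : ∀ {v} → ¬ (w ⊒ v) → late (b v) ≡ true
  b-late = cong not ∘ dec-false (w ⊒? _)

-- Leaves, the realizer and the dimension.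

Leaf : ℕ → Set
Leaf = Vec Bool

Leaf↔Fin : ∀ m → Leaf m ↔ Fin (2 ^ m)
Leaf↔Fin 0       = ↔-sym Fin.1↔⊤ ↔-∘ contract
  where
  contract : Leaf 0 ↔ ⊤
  contract = mk↔ₛ′ (λ _ → tt) (λ _ → []) (λ _ → refl) (λ { [] → refl })
Leaf↔Fin (suc m) = Bool×↔Fin (Leaf↔Fin m) ↔-∘ uncons
  where
  uncons : Leaf (suc m) ↔ (Bool × Leaf m)
  uncons = mk↔ₛ′ (λ { (c ∷ l) → c , l }) (λ { (c , l) → c ∷ l }) (λ _ → refl) (λ { (_ ∷ _) → refl })

-- The word is padded with letters `false`; `≤′` supplies the missing ones one at a time.
leafAbove′ : ∀ {m} u → length u ≤′ m → ∃[ l ] toList {n = m} l ⊒ u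
leafAbove′ u (≤′-reflexive refl) = Vec.fromList u , subst (_⊒ u) (sym (toList∘fromList u)) ⊒-refl
leafAbove′ u (≤′-step p)         = let l , l⊒u = leafAbove′ u p in false ∷ l , ⊒-step l⊒u

leafAbove : ∀ {m} u → length u ≤ m → ∃[ l ] toList {n = m} l ⊒ u
leafAbove u = leafAbove′ u ∘ ℕ.≤⇒≤′

toList-injective : ∀ {m} {l l′ : Leaf m} → toList l ≡ toList l′ → l ≡ l′
toList-injective {l = l} {l′} eq = trans (sym (cast-is-id refl l)) (toList-injective-cast refl l l′ eq)

leaves-∥ : ∀ {m} {l l′ : Leaf m} → l ≢ l′ → toList l ∥ toList l′
leaves-∥ {l = l} {l′} l≢l′ with compare (toList l) (toList l′)
... | inj₂ (inj₂ l∥l′) = l∥l′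
... | inj₁ l⊒l′        = contradiction
  (toList-injective (⊒∧length≡⇒≡ l⊒l′ (trans (length-toList l) (sym (length-toList l′))))) l≢l′
... | inj₂ (inj₁ l′⊒l) = contradiction
  (sym (toList-injective (⊒∧length≡⇒≡ l′⊒l (trans (length-toList l′) (sym (length-toList l)))))) l≢l′

∥-letter : ∀ c u → ∃[ d ] c ∷ u ∥ d ∷ []
∥-letter c []      = not c , fork (Bool.not-¬ refl)
∥-letter c (d ∷ u) = let e , r = ∥-letter d u in e , stepˡ r

module _ (n : ℕ) where
  private
    P = poset n

  private
    falses : Leaf (suc n)
    falses = Vec.replicate _ false

  -- On one side, q ≼ p is respected by the order of every leaf. Otherwise a leaf above a suitable
  -- word makes q early and p late; for p on the `b` side and q on the `a` side it is enough that q
  -- is early, since `position` already favours q.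
  reversing-leaf : ∀ p q → 0 < length (proj₂ q) → length (proj₂ p) ≤ suc n → length (proj₂ q) ≤ suc n →
                   ¬ (p ≼ q) → ∃[ l ] Before (toList {n = suc n} l) q p
  reversing-leaf p@(a u) q@(a v) _ ℓ _ p⋠q with compare u v
  ... | inj₁ u⊒v        = contradiction (a≼a u⊒v) p⋠q
  ... | inj₂ (inj₁ v⊒u) = falses , ≼⇒before (toList falses) q p (a≼a v⊒u)
  ... | inj₂ (inj₂ u∥v) = let l , l⊒u = leafAbove u ℓ; w = toList l in
    l , early-before-late w q p (a-early w (∥⇒no-upper-bound u∥v l⊒u)) (a-late w l⊒u)
  reversing-leaf p@(b u) q@(b v) _ _ ℓ p⋠q with compare u v
  ... | inj₁ u⊒v        = falses , ≼⇒before (toList falses) q p (b≼b u⊒v)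
  ... | inj₂ (inj₁ v⊒u) = contradiction (b≼b v⊒u) p⋠q
  ... | inj₂ (inj₂ u∥v) = let l , l⊒v = leafAbove v ℓ; w = toList l in
    l , early-before-late w q p (b-early w l⊒v) (b-late w λ l⊒u → ∥⇒no-upper-bound u∥v l⊒u l⊒v)
  reversing-leaf p@(a u) q@(b v) _ ℓ ℓ′ p⋠q with compare u v
  ... | inj₂ (inj₂ u∥v) = contradiction (a≼b u∥v) p⋠q
  -- A leaf above the longer word is above both, which makes `b v` early and `a u` late.
  ... | inj₁ u⊒v        = let l , l⊒u = leafAbove u ℓ; w = toList l in
    l , early-before-late w q p (b-early w (⊒-trans l⊒u u⊒v)) (a-late w l⊒u)
  ... | inj₂ (inj₁ v⊒u) = let l , l⊒v = leafAbove v ℓ′; w = toList l in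
    l , early-before-late w q p (b-early w l⊒v) (a-late w (⊒-trans l⊒v v⊒u))
  reversing-leaf p@(b _) q@(a (c ∷ v)) _ _ _ _ =
    -- The leaf lies in the other half of the tree, so it does not extend `c ∷ v`, and `a (c ∷ v)`
    -- is early.
    let d , v∥d = ∥-letter c v
        l , l⊒d = leafAbove (d ∷ []) (s≤s z≤n)
        w       = toList l
        early   = a-early w λ l⊒v → ∥⇒no-upper-bound v∥d l⊒v l⊒d
    in l , before-mono w q p (subst (Bool._≤ late w p) (sym early) (Bool.≤-minimum _)) -≤+

  private
    leaf : Fin (2 ^ suc n) → List Bool
    leaf = toList ∘ Inverse.from (Leaf↔Fin (suc n))

  realizer : IsIntersectionOfLinearOrders P (2 ^ suc n)
  realizer =
      (λ i → Before (leaf i) on loc)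
    , before-on-loc
    , λ x y → mk⇔ (λ x⊑y i → ≼⇒before (leaf i) (loc x) (loc y) x⊑y)
                  (λ before → decidable-stable (loc x ≼? loc y) (not-reversed x y before))
    where
    before-on-loc : ∀ i → IsTotalOrder _≡_ (Before (leaf i) on loc)
    before-on-loc i = record
      { isPartialOrder = on-isPartialOrder loc loc-injective T.isPartialOrder
      ; total          = λ x y → T.total (loc x) (loc y)
      }
      where module T = IsTotalOrder (before-isTotalOrder (leaf i))

    not-reversed : ∀ x y → (∀ i → Before (leaf i) (loc x) (loc y)) → ¬ ¬ (x ⊑ y)
    not-reversed x y before x⋢y = x⋢y (subst (loc x ≼_) x≡y ≼-refl)
      where
      l,yx = reversing-leaf (loc x) (loc y) (s≤s z≤n) (word-length x) (word-length y) x⋢y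
      open Inverse (Leaf↔Fin (suc n)) using (to; strictlyInverseʳ)
      x≡y : loc x ≡ loc y
      x≡y = IsTotalOrder.antisym (before-isTotalOrder (toList (proj₁ l,yx)))
        (subst (λ l → Before (toList l) (loc x) (loc y)) (strictlyInverseʳ _) (before (to (proj₁ l,yx))))
        (proj₂ l,yx)

  leafElement : Bool → Leaf (suc n) → Element n
  leafElement s (c ∷ l) = s , c , toList l , [ ℕ.≤-reflexive (length-toList l) ]

  loc-leafElement : ∀ s l → loc (leafElement s l) ≡ (s , toList l)
  loc-leafElement s (_ ∷ _) = refl

  dimension : HasDimension P (2 ^ suc n)
  dimension = realizer , λ e → standardExample⇒≤ P
    (leafElement false ∘ from) (leafElement true ∘ from)
    (λ i → uᵢ⋢vᵢ (from i))
    (λ i j i≢j → uᵢ⊑vⱼ _ _ (i≢j ∘ Injection.injective (↔⇒↣ (↔-sym (Leaf↔Fin (suc n))))))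
    where
    open Inverse (Leaf↔Fin (suc n)) using (from)

    uᵢ⋢vᵢ : ∀ l → ¬ (leafElement false l ⊑ leafElement true l)
    uᵢ⋢vᵢ (_ ∷ _) (a≼b l∥l) = ∥-irrefl l∥l

    uᵢ⊑vⱼ : ∀ l l′ → l ≢ l′ → leafElement false l ⊑ leafElement true l′
    uᵢ⊑vⱼ l l′ l≢l′ rewrite loc-leafElement false l | loc-leafElement true l′ = a≼b (leaves-∥ l≢l′)

-- The cover graph.

-- On the six vertices of a node these edges form the hexagon a_w, a_0w, b_1w, b_w, b_0w, a_1w. Its
-- long diagonals are the glueing pairs {a_u, b_u}; adding them yields K₃,₃.
data Edge : Rel Location 0ℓ where
  up    : ∀ {s c u} → Edge (s , u) (s , c ∷ u)
  down  : ∀ {s c u} → Edge (s , c ∷ u) (s , u)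
  cross : ∀ {s t c d u} → s ≢ t → c ≢ d → Edge (s , c ∷ u) (t , d ∷ u)

edge-sym : ∀ {p q} → Edge p q → Edge q p
edge-sym up              = down
edge-sym down            = up
edge-sym (cross s≢t c≢d) = cross (≢-sym s≢t) (≢-sym c≢d)

∥-nonempty : ∀ {u v} → u ∥ v → 0 < length u
∥-nonempty (fork _)  = z<s
∥-nonempty (stepˡ _) = z<s
∥-nonempty (stepʳ p) = ∥-nonempty p

c∷u≢u : ∀ {s c : Bool} {u : List Bool} → (s , u) ≢ (s , c ∷ u)
c∷u≢u eq = ℕ.1+n≢n (sym (cong (length ∘ proj₂) eq))

-- Unless the words are equal or form a bare fork, dropping the head of one of them gives a location
-- between p and q, which by tightness is an end. Tightness speaks only of nonempty words no longer
-- than one of the ends, so that the location belongs to the same finite poset.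
tight⇒edge : ∀ {p q} → 0 < length (proj₂ p) → 0 < length (proj₂ q) → p ≢ q → p ≼ q →
             (∀ r → 0 < length (proj₂ r) →
               length (proj₂ r) ≤ length (proj₂ p) ⊎ length (proj₂ r) ≤ length (proj₂ q) →
               p ≼ r → r ≼ q → r ≡ p ⊎ r ≡ q) →
             Edge p q
tight⇒edge _ _ p≢q (a≼a ⊒-refl) _ = contradiction refl p≢q
tight⇒edge _ v>0 _ (a≼a (⊒-step {u = u} u⊒v)) tight
  with tight (a u) (ℕ.≤-trans v>0 (⊒-length u⊒v)) (inj₁ (ℕ.n≤1+n _)) (a≼a (⊒-step ⊒-refl)) (a≼a u⊒v)
... | inj₁ r≡p  = contradiction r≡p c∷u≢u
... | inj₂ refl = down
tight⇒edge _ _ p≢q (b≼b ⊒-refl) _ = contradiction refl p≢q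
tight⇒edge u>0 _ _ (b≼b (⊒-step {u = v} v⊒u)) tight
  with tight (b v) (ℕ.≤-trans u>0 (⊒-length v⊒u)) (inj₂ (ℕ.n≤1+n _)) (b≼b v⊒u) (b≼b (⊒-step ⊒-refl))
... | inj₁ refl = up
... | inj₂ r≡q  = contradiction r≡q c∷u≢u
tight⇒edge _ _ _ (a≼b (fork c≢d)) _ = cross (λ ()) c≢d
tight⇒edge _ _ _ (a≼b (stepˡ {u = u} u∥v)) tight
  with tight (a u) (∥-nonempty u∥v) (inj₁ (ℕ.n≤1+n _)) (a≼a (⊒-step ⊒-refl)) (a≼b u∥v)
... | inj₁ r≡p = contradiction r≡p c∷u≢u
... | inj₂ ()
tight⇒edge _ _ _ (a≼b (stepʳ {v = v} u∥v)) tight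
  with tight (b v) (∥-nonempty (∥-sym u∥v)) (inj₂ (ℕ.n≤1+n _)) (a≼b u∥v) (b≼b (⊒-step ⊒-refl))
... | inj₁ ()
... | inj₂ r≡q = contradiction r≡q c∷u≢u

cover⇒edge : ∀ {n} {x y : Element n} → Cover (poset n) x y → Edge (loc x) (loc y)
cover⇒edge {n} {x} {y} (x⊑y , x≢y , nothing-between) =
  tight⇒edge z<s z<s (x≢y ∘ loc-injective) x⊑y tight
  where
  tight : ∀ r → 0 < length (proj₂ r) →
          length (proj₂ r) ≤ length (word x) ⊎ length (proj₂ r) ≤ length (word y) →
          loc x ≼ r → r ≼ loc y → r ≡ loc x ⊎ r ≡ loc y
  tight r r>0 bound x≼r r≼y with r ≟ˡᵒᶜ loc x | r ≟ˡᵒᶜ loc y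
  ... | yes r≡x | _       = inj₁ r≡x
  ... | no  _   | yes r≡y = inj₂ r≡y
  ... | no  r≢x | no  r≢y = contradiction
    (z , (λ z≡x → r≢x (trans (sym z≡r) (cong loc z≡x)))
       , (λ z≡y → r≢y (trans (sym z≡r) (cong loc z≡y)))
       , subst (loc x ≼_) (sym z≡r) x≼r , subst (_≼ loc y) (sym z≡r) r≼y)
    nothing-between
    where
    z,z≡r = element (proj₁ r) (proj₂ r) r>0
      ([ (λ ℓ → ℕ.≤-trans ℓ (word-length x)) , (λ ℓ → ℕ.≤-trans ℓ (word-length y)) ]′ bound)
    z = proj₁ z,z≡r
    z≡r = proj₂ z,z≡r

-- The part strictly above v is attached to the rest only at `a v` and `b v`: tree edges move by one
-- letter, and crossing edges exchange siblings.
edge-⊐ : ∀ {p q v} → Edge p q → proj₂ p ⊐ v → proj₂ q ⊐ v ⊎ proj₂ q ≡ v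
edge-⊐ up          (d , u⊒dv)     = inj₁ (d , ⊒-step u⊒dv)
edge-⊐ down        (_ , ⊒-refl)   = inj₂ refl
edge-⊐ down        (d , ⊒-step p) = inj₁ (d , p)
edge-⊐ (cross _ _) (_ , ⊒-refl)   = inj₁ (_ , ⊒-refl)
edge-⊐ (cross _ _) (d , ⊒-step p) = inj₁ (d , ⊒-step p)

-- The copy of K₃,₃ at a node.

Hexad : Set
Hexad = Bool × Maybe Bool

Hexad↔Fin : Hexad ↔ Fin 6
Hexad↔Fin = Bool×↔Fin Maybe↔Fin
  where
  Maybe↔Fin : Maybe Bool ↔ Fin 3
  Maybe↔Fin = mk↔ₛ′
    (λ { nothing → 0F ; (just false) → 1F ; (just true) → 2F })
    (λ { 0F → nothing ; 1F → just false ; 2F → just true })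
    (λ { 0F → refl ; 1F → refl ; 2F → refl })
    (λ { nothing → refl ; (just false) → refl ; (just true) → refl })

_≟ʰ_ : Decidable {A = Hexad} _≡_
_≟ʰ_ = Product.≡-dec Bool._≟_ (Maybe.≡-dec Bool._≟_)

-- The bipartition of K₃,₃ into {a_w, b_0w, b_1w} and {b_w, a_0w, a_1w}.
colour : Hexad → Bool
colour (s , nothing) = s
colour (s , just _)  = not s

colour-injective : ∀ {s t z} → colour (s , z) ≡ colour (t , z) → s ≡ t
colour-injective {z = nothing} eq = eq
colour-injective {z = just _}  eq = Bool.not-injective eq

module Node (w : List Bool) where

  centre : Maybe Bool → List Bool
  centre nothing  = w
  centre (just c) = c ∷ w

  hexad : Hexad → Location
  hexad (s , z) = s , centre z

  -- Deleting the six vertices leaves the part outside the subtree at w and the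
  -- parts above its two children; each zone is one of these parts together
  -- with the two vertices it is attached to.
  Zone : Maybe Bool → List Bool → Set
  Zone nothing  v = ¬ (v ⊐ w)
  Zone (just c) v = v ⊒ c ∷ w

  centre∈zone : ∀ z → Zone z (centre z)
  centre∈zone nothing  = ⊒⇒⊅ ⊒-refl
  centre∈zone (just _) = ⊒-refl

  zone-unique : ∀ {z z′ v} → Zone z v → Zone z′ v → z ≡ z′
  zone-unique {nothing} {nothing} _   _   = refl
  zone-unique {nothing} {just _}  v⊅w v⊒  = contradiction (_ , v⊒) v⊅w
  zone-unique {just _}  {nothing} v⊒  v⊅w = contradiction (_ , v⊒) v⊅w
  zone-unique {just _}  {just _}  v⊒  v⊒′ = cong just (⊒-letter-unique v⊒ v⊒′)

  -- Only edges between w and a child, or between the two children, change the zone. The former keep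
  -- the side but exchange `nothing` and `just`, the latter switch the side between two `just`;
  -- either way the colour changes.
  edge-zone : ∀ {s u t v} z → Edge (s , u) (t , v) → Zone z u →
              Zone z v ⊎ (∃[ z′ ] u ≡ centre z × v ≡ centre z′ × colour (s , z) ≢ colour (t , z′))
  edge-zone (just _) up             u∈z          = inj₁ (⊒-step u∈z)
  edge-zone (just _) down           ⊒-refl       = inj₂ (nothing , refl , refl , ≢-sym (Bool.not-¬ refl))
  edge-zone (just _) down           (⊒-step u∈z) = inj₁ u∈z
  edge-zone (just _) (cross s≢t _)  ⊒-refl       = inj₂ (just _ , refl , refl , s≢t ∘ Bool.not-injective)
  edge-zone (just _) (cross _ _)    (⊒-step u∈z) = inj₁ (⊒-step u∈z)
  edge-zone nothing (up {u = u})    u∈z with u ≟ᴸ w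
  ... | yes refl = inj₂ (just _ , refl , refl , Bool.not-¬ refl)
  ... | no  u≢w  = inj₁ λ { (_ , ⊒-refl) → u≢w refl ; (_ , ⊒-step p) → u∈z (_ , p) }
  edge-zone nothing down            u∈z = inj₁ λ { (_ , p) → u∈z (_ , ⊒-step p) }
  edge-zone nothing (cross _ _)     u∈z = inj₁ λ { (_ , ⊒-refl) → u∈z (_ , ⊒-refl)
                                                 ; (_ , ⊒-step p) → u∈z (_ , ⊒-step p) }

-- Branch sets of a K₅ model.

no-three-Bools : ∀ {x y z : Bool} → x ≢ y → x ≢ z → y ≢ z → ⊥
no-three-Bools x≢y x≢z y≢z = x≢y (trans (Bool.¬-not x≢z) (sym (Bool.¬-not y≢z)))

module _ {n : ℕ} (M : K 5 IsMinorOf coverGraph (poset n)) where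
  open FinPoset (poset n) using (enumeration)
  open _IsMinorOf_ M

  adj⇒edge : ∀ {x y} → Graph.Adj (coverGraph (poset n)) x y → Edge (loc x) (loc y)
  adj⇒edge (inj₁ x⋖y) = cover⇒edge x⋖y
  adj⇒edge (inj₂ y⋖x) = edge-sym (cover⇒edge y⋖x)

  confined : ∀ i (Z : List Bool → Set) →
             (∀ {x y} → branch i x → branch i y → Edge (loc x) (loc y) → Z (word x) → Z (word y)) →
             ∀ {x} → branch i x → Z (word x) → ∀ {y} → branch i y → Z (word y)
  confined i Z closed x∈i Zx y∈i = along (connected i x∈i y∈i) Zx
    where
    along : ∀ {x y} → Star _ x y → Z (word x) → Z (word y)
    along ε                         Zx = Zx
    along ((x∈i , y∈i , xy) ◅ path) Zx = along path (closed x∈i y∈i (adj⇒edge xy) Zx)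

  Hits : Fin 5 → Location → Set
  Hits i p = ∃[ x ] branch i x × loc x ≡ p

  hits? : ∀ i p → Dec (Hits i p)
  hits? i p = dec-∃ enumeration λ x → branch? i x ×-dec (loc x ≟ˡᵒᶜ p)

  hits-unique : ∀ {i j p} → Hits i p → Hits j p → i ≡ j
  hits-unique {i} {j} (x , x∈i , x≡p) (y , y∈j , y≡p) with i Fin.≟ j
  ... | yes i≡j = i≡j
  ... | no  i≢j = ⊥-elim (disjoint i≢j (x∈i , subst (branch j) (loc-injective (trans y≡p (sym x≡p))) y∈j))

  Above : Fin 5 → List Bool → Set
  Above i v = ∀ {x} → branch i x → word x ⊐ v

  -- The node where the climb stops.

  module AtNode (w : List Bool) (i₀ : Fin 5) (above : Above i₀ w)
                (stop : ∀ c i → ¬ Above i (c ∷ w)) where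
    open Node w

    -- By `edge-⊐` the branch set could leave the part above `centre z` only through a vertex at
    -- `centre z`, which is one of the six.
    stays-above : ∀ z i → (∀ q → ¬ Hits i (hexad q)) →
                  ∀ {x} → branch i x → word x ⊐ centre z → Above i (centre z)
    stays-above z i none = confined i (_⊐ centre z) λ {x} {y} _ y∈i xy x⊐ →
      [ (λ y⊐ → y⊐) , (λ y≡ → ⊥-elim (none (side y , z) (y , y∈i , cong (side y ,_) y≡))) ]′ (edge-⊐ xy x⊐)

    -- The set is joined to that of `i₀`, which lies above w. The joining edge ends above w or at w,
    -- and the latter would be a hit.
    above-w : ∀ i → (∀ q → ¬ Hits i (hexad q)) → Above i w
    above-w i none with i₀ Fin.≟ i
    ... | yes refl = above
    ... | no  i₀≢i with joined i₀≢i
    ...   | x , y , x∈i₀ , y∈i , xy with edge-⊐ (adj⇒edge xy) (above x∈i₀)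
    ...     | inj₁ y⊐w = stays-above nothing i none y∈i y⊐w
    ...     | inj₂ y≡w = ⊥-elim (none (side y , nothing) (y , y∈i , cong (side y ,_) y≡w))

    abstract
      -- A set missing all six vertices lies above w, so it has a vertex at or above a child of w.
      -- At the child this is a hit; strictly above, the whole set lies there, against `stop`.
      hits-hexad : ∀ i → ∃[ q ] Hits i (hexad q)
      hits-hexad i = decidable-stable (dec-∃ Hexad↔Fin (λ q → hits? i (hexad q))) λ none′ →
        let none    = λ q h → none′ (q , h)
            x , x∈i = nonempty i
            c , x⊒cw = above-w i none x∈i
        in [ (λ x≡cw → none (side x , just c) (x , x∈i , cong (side x ,_) x≡cw))
           , (λ x⊐cw → stop c i (stays-above (just c) i none x∈i x⊐cw))
           ]′ (⊒-split x⊒cw)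

    rep : Fin 5 → Hexad
    rep i = proj₁ (hits-hexad i)

    hits-rep : ∀ i → Hits i (hexad (rep i))
    hits-rep i = proj₂ (hits-hexad i)

    Extra : Fin 5 → Set
    Extra i = ∃[ q ] q ≢ rep i × Hits i (hexad q)

    extra? : ∀ i → Dec (Extra i)
    extra? i = dec-∃ Hexad↔Fin λ q → ¬? (q ≟ʰ rep i) ×-dec hits? i (hexad q)

    -- Pigeonhole: the five representatives and k further vertices from distinct branch sets are all
    -- different, and there are only six places.
    extra-count : ∀ {k} (e : Fin k → ∃ Extra) → Injective _≡_ _≡_ (proj₁ ∘ e) → 5 + k ≤ 6
    extra-count {k} e e-injective = Fin.injective⇒≤
      (Injection.injective (↔⇒↣ (Fin.+↔⊎ {5} {k})) ∘ f-injective _ _ ∘ Injection.injective (↔⇒↣ Hexad↔Fin))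
      where
      f : Fin 5 ⊎ Fin k → Hexad
      f (inj₁ i) = rep i
      f (inj₂ j) = proj₁ (proj₂ (e j))

      hits-f : ∀ j → Hits (proj₁ (e j)) (hexad (f (inj₂ j)))
      hits-f j = proj₂ (proj₂ (proj₂ (e j)))

      rep≢extra : ∀ i j → rep i ≢ f (inj₂ j)
      rep≢extra i j eq = proj₁ (proj₂ (proj₂ (e j))) (trans (sym eq) (cong rep i≡))
        where
        -- Disjointness allows a clash only within one branch set, where the extra vertex differs
        -- from the representative by definition.
        i≡ : i ≡ proj₁ (e j)
        i≡ = hits-unique (hits-rep i) (subst (Hits (proj₁ (e j)) ∘ hexad) (sym eq) (hits-f j))

      f-injective : ∀ x y → f x ≡ f y → x ≡ y
      f-injective (inj₁ i) (inj₁ j) eq = cong inj₁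
        (hits-unique (hits-rep i) (subst (Hits j ∘ hexad) (sym eq) (hits-rep j)))
      f-injective (inj₁ i) (inj₂ j) eq = contradiction eq (rep≢extra i j)
      f-injective (inj₂ i) (inj₁ j) eq = contradiction (sym eq) (rep≢extra j i)
      f-injective (inj₂ i) (inj₂ j) eq = cong inj₂
        (e-injective (hits-unique (hits-f i) (subst (Hits (proj₁ (e j)) ∘ hexad) (sym eq) (hits-f j))))

    -- Two sets with extra vertices would need seven vertices.
    extra-unique : ∀ {i j} → i ≢ j → Extra i → ¬ Extra j
    extra-unique {i} {j} i≢j eᵢ eⱼ = ℕ.1+n≰n (extra-count (λ { 0F → i , eᵢ ; 1F → j , eⱼ })
      λ { {0F} {0F} _ → refl ; {0F} {1F} eq → contradiction eq i≢j
        ; {1F} {0F} eq → contradiction (sym eq) i≢j ; {1F} {1F} _ → refl })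

    hits⇒rep : ∀ {i} → ¬ Extra i → ∀ q → Hits i (hexad q) → q ≡ rep i
    hits⇒rep {i} ¬extra q h = decidable-stable (q ≟ʰ rep i) λ q≢ → ¬extra (q , q≢ , h)

    zone-rep : ∀ i → Maybe Bool
    zone-rep = proj₂ ∘ rep

    hits-centre : ∀ {i x} z → branch i x → word x ≡ centre z → Hits i (hexad (side x , z))
    hits-centre {x = x} z x∈i eq = x , x∈i , cong (side x ,_) eq

    -- Leaving the zone would take an edge between two differently coloured vertices of the six, but
    -- the set contains only one of the six.
    within-zone : ∀ {i} → ¬ Extra i → ∀ {x} → branch i x → Zone (zone-rep i) (word x)
    within-zone {i} ¬extra with hits-rep i
    ... | x₀ , x₀∈i , x₀≡ = confined i (Zone z) closed x₀∈i
      (subst (Zone z) (sym (cong proj₂ x₀≡)) (centre∈zone z))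
      where
      z = zone-rep i
      closed : ∀ {x y} → branch i x → branch i y → Edge (loc x) (loc y) → Zone z (word x) → Zone z (word y)
      closed x∈i y∈i xy x∈z with edge-zone z xy x∈z
      ... | inj₁ y∈z = y∈z
      ... | inj₂ (z′ , x≡ , y≡ , colours≢) = contradiction
        (cong colour (trans (hits⇒rep ¬extra _ (hits-centre z x∈i x≡))
                       (sym (hits⇒rep ¬extra _ (hits-centre z′ y∈i y≡)))))
        colours≢

    -- Take an edge joining the two sets. If it stays in one zone, both representatives lie in that
    -- zone, where each colour occurs once. Otherwise its ends are among the six, so they are the
    -- representatives, and their colours differ.
    colours-differ : ∀ {i j} → i ≢ j → ¬ Extra i → ¬ Extra j → colour (rep i) ≢ colour (rep j)
    colours-differ {i} {j} i≢j ¬eᵢ ¬eⱼ colour≡ with joined i≢j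
    ... | x , y , x∈i , y∈j , xy with edge-zone (zone-rep i) (adj⇒edge xy) (within-zone ¬eᵢ x∈i)
    ...   | inj₁ y∈zᵢ = i≢j (hits-unique (hits-rep i) (subst (Hits j ∘ hexad) (sym rep≡) (hits-rep j)))
      where
      zone≡ : zone-rep i ≡ zone-rep j
      zone≡ = zone-unique y∈zᵢ (within-zone ¬eⱼ y∈j)
      rep≡ : rep i ≡ rep j
      rep≡ = cong₂ _,_ (colour-injective {z = zone-rep i}
        (trans colour≡ (cong (λ z → colour (proj₁ (rep j) , z)) (sym zone≡)))) zone≡
    ...   | inj₂ (z′ , x≡ , y≡ , colours≢) = colours≢
      (trans (cong colour (hits⇒rep ¬eᵢ _ (hits-centre _ x∈i x≡)))
        (trans colour≡ (sym (cong colour (hits⇒rep ¬eⱼ _ (hits-centre z′ y∈j y≡))))))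

    no-three-singles : ∀ {i j k} → i ≢ j → i ≢ k → j ≢ k → ¬ Extra i → ¬ Extra j → ¬ Extra k → ⊥
    no-three-singles i≢j i≢k j≢k ¬eᵢ ¬eⱼ ¬eₖ = no-three-Bools
      (colours-differ i≢j ¬eᵢ ¬eⱼ) (colours-differ i≢k ¬eᵢ ¬eₖ) (colours-differ j≢k ¬eⱼ ¬eₖ)

    impossible : ⊥
    -- At most one set has an extra vertex, so three sets without one are found among the first
    -- four; two colours do not suffice for them.
    impossible with extra? 0F | extra? 1F | extra? 2F
    ... | no ¬e₀ | no ¬e₁ | no ¬e₂ = no-three-singles (λ ()) (λ ()) (λ ()) ¬e₀ ¬e₁ ¬e₂
    ... | yes e  | _      | _      = no-three-singles {1F} {2F} {3F} (λ ()) (λ ()) (λ ())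
      (extra-unique (λ ()) e) (extra-unique (λ ()) e) (extra-unique (λ ()) e)
    ... | no _   | yes e  | _      = no-three-singles {0F} {2F} {3F} (λ ()) (λ ()) (λ ())
      (extra-unique (λ ()) e) (extra-unique (λ ()) e) (extra-unique (λ ()) e)
    ... | no _   | no _   | yes e  = no-three-singles {0F} {1F} {3F} (λ ()) (λ ()) (λ ())
      (extra-unique (λ ()) e) (extra-unique (λ ()) e) (extra-unique (λ ()) e)

  -- Induction on k, a bound for the number of levels left above w. At the top, words would exceed
  -- the maximal length; below, the induction hypothesis for the two children is the stopping
  -- condition at w.
  none-above : ∀ k w → suc n ≤ k + length w → ∀ i → ¬ Above i w
  none-above 0       w n<w i above with nonempty i
  ... | x , x∈i = ℕ.<⇒≱ (⊒-length (proj₂ (above x∈i))) (ℕ.≤-trans (word-length x) n<w)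
  none-above (suc k) w n<k+w i above = AtNode.impossible w i above λ c →
    none-above k (c ∷ w) (ℕ.≤-trans n<k+w (ℕ.≤-reflexive (sym (ℕ.+-suc k (length w)))))

  no-K₅-minor : ⊥
  -- The empty word carries no element, so every branch set lies strictly above it and the choice of
  -- `0F` is arbitrary.
  no-K₅-minor = none-above (suc n) [] (ℕ.m≤m+n _ _) 0F λ {x} _ → nonempty-⊐ (word x) z<s
    where
    nonempty-⊐ : ∀ u → 0 < length u → u ⊐ []
    nonempty-⊐ u u>0 with ⊒-split (⊒-[] {u})
    ... | inj₂ u⊐[] = u⊐[]
    ... | inj₁ refl = contradiction u>0 λ ()

theorem4 : (h : ℕ) → 2 ≤ h → 2 ∣ h →
    Σ[ P ∈ FinPoset ]
    ( HasHeight P h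
    × (∃[ d ] (HasDimension P d × 2 ^ (h / 2) ≤ d))
    × ¬ (K 5 IsMinorOf coverGraph P) )
theorem4 _ () (divides 0 refl)
theorem4 _ _  (divides (suc n) refl) =
  poset n , height n
  , (2 ^ suc n , dimension n , ℕ.≤-reflexive (cong (2 ^_) (m*n/n≡m (suc n) 2)))
  , no-K₅-minor
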